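{- Let $G$ be a finite abelian group of even order, so that $G$ can be written as an internal direct product $G=\langle c\rangle\times A$ for some element $c\in G$ of order $2^k$ with $k\ge 1$ and some subgroup $A<G$; fix such $c$, $k$ and $A$. Let $S\subseteq G$ be closed under inversion and let $\Gamma=\mathrm{Cay}(G,S)$. Let $H=\langle c^2\rangle\times A\le G$. Then $\Gamma$ is a Cayley graph on the generalized dihedral group $\mathrm{Dih}(H)$.
   Context: For a group $G$ and a subset $S\subseteq G$ closed under inversion ($S=S^{ -1}$), the Cayley graph $\mathrm{Cay}(G,S)$ is the (undirected) graph with vertex set $G$ in which $u$ and $v$ are adjacent if and only if $v=su$ for some $s\in S$. (The identity is usually omitted from $S$ to avoid loops.) A graph $\Gamma$ is said to be a Cayley graph on a group $K$ if $\Gamma$ is isomorphic to $\mathrm{Cay}(K,T)$ for some inverse-closed $T\subseteq K$; equivalently, $\mathrm{Aut}(\Gamma)$ contains a subgroup isomorphic to $K$ acting regularly on $V(\Gamma)$. For an abelian group $B$, the generalized dihedral group is $\mathrm{Dih}(B)=\langle B,x\rangle$, where $x\notin B$, $x^2=1$ and $bx=xb^{ -1}$ for every $b\in B$; that is, the semidirect product of $B$ with a group of order $2$ acting by inversion, so that $B$ has index $2$ in $\mathrm{Dih}(B)$. -}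

module Defs where

open import Algebra.Bundles using (Group; AbelianGroup)
import Algebra.Definitions.RawMonoid as RawMonoidDefs
import Algebra.Properties.AbelianGroup as AbelianGroupProperties
import Algebra.Properties.Group as GroupProperties
open import Data.Fin.Base using (Fin)
open import Data.Nat.Base using (ℕ; _≤_; _<_)
open import Data.Product.Base using (Σ; ∃; ∃-syntax; _×_; _,_; proj₁; proj₂)
open import Data.Sign.Base as Sign using (Sign)
import Data.Sign.Properties as Signₚ
open import Function.Base using (_on_)
open import Function.Bundles using (Bijection; _⇔_)
open import Level using (Level; _⊔_; suc)
open import Relation.Binary.Bundles using (Setoid)
open import Relation.Binary.Core using (Rel)
open import Relation.Binary.Definitions using (Symmetric; _Respects_; _Respects₂_)
open import Relation.Binary.PropositionalEquality.Core as ≡ using (_≡_)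
import Relation.Binary.PropositionalEquality.Properties as ≡ₚ
open import Relation.Nullary.Negation.Core using (¬_)
import Relation.Binary.Construct.On as On
import Relation.Binary.Reasoning.Setoid as SetoidReasoning
open import Relation.Unary using (Pred; _∈_)

------------------------------------------------------------------------
-- Graphs

-- Undirected, without multiple edges; loops are allowed, because a
-- connection set may contain the identity.
record Graph (v ℓ e : Level) : Set (suc (v ⊔ ℓ ⊔ e)) where
  field
    vertices : Setoid v ℓ
  open Setoid vertices public using (_≈_) renaming (Carrier to Vertex)
  field
    Adj       : Rel Vertex e
    Adj-resp  : Adj Respects₂ _≈_
    Adj-sym   : Symmetric Adj

infix 4 _≅_

record _≅_ {v₁ ℓ₁ e₁ v₂ ℓ₂ e₂ : Level} (Γ : Graph v₁ ℓ₁ e₁) (Δ : Graph v₂ ℓ₂ e₂)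
           : Set (v₁ ⊔ ℓ₁ ⊔ e₁ ⊔ v₂ ⊔ ℓ₂ ⊔ e₂) where
  private
    module Γ = Graph Γ
    module Δ = Graph Δ
  field
    bijection : Bijection Γ.vertices Δ.vertices
  open Bijection bijection public using (to)
  field
    adjacency : ∀ u v → Γ.Adj u v ⇔ Δ.Adj (to u) (to v)

------------------------------------------------------------------------
-- Cayley graphs

record InverseClosedSubset {c ℓ : Level} (G : Group c ℓ) (s : Level) : Set (c ⊔ ℓ ⊔ suc s) where
  open Group G
  field
    member    : Pred Carrier s
    resp      : member Respects _≈_
    ⁻¹-closed : ∀ {x} → x ∈ member → x ⁻¹ ∈ member

Cay : {c ℓ s : Level} (G : Group c ℓ) → InverseClosedSubset G s → Graph c ℓ (c ⊔ ℓ ⊔ s)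
Cay G S = record
  { vertices = setoid
  ; Adj      = λ u v → ∃[ s ] s ∈ S.member × v ≈ s ∙ u
  ; Adj-resp = (λ v≈w (s , s∈S , v≈su) → s , s∈S , trans (sym v≈w) v≈su)
             , (λ u≈w (s , s∈S , v≈su) → s , s∈S , trans v≈su (∙-congˡ u≈w))
  ; Adj-sym  = λ {u} {v} (s , s∈S , v≈su) → s ⁻¹ , S.⁻¹-closed s∈S , (begin
      u               ≈⟨ \\-leftDividesʳ s u ⟨
      s ⁻¹ ∙ (s ∙ u)  ≈⟨ ∙-congˡ v≈su ⟨
      s ⁻¹ ∙ v        ∎)
  }
  where
  module S = InverseClosedSubset S
  open Group G
  open GroupProperties G
  open SetoidReasoning setoid

IsCayleyGraphOn : {v ℓ₁ e c ℓ₂ : Level} (t : Level) →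
                  Graph v ℓ₁ e → Group c ℓ₂ → Set (v ⊔ ℓ₁ ⊔ e ⊔ c ⊔ ℓ₂ ⊔ suc t)
IsCayleyGraphOn t Γ K = Σ (InverseClosedSubset K t) λ T → Γ ≅ Cay K T

------------------------------------------------------------------------
-- Orders of groups and of elements

GroupHasOrder : {c ℓ : Level} → Group c ℓ → ℕ → Set (c ⊔ ℓ)
GroupHasOrder G n = Bijection (Group.setoid G) (≡ₚ.setoid (Fin n))

module _ {c ℓ : Level} (G : Group c ℓ) where
  open Group G

  pow : Carrier → ℕ → Carrier
  pow x n = RawMonoidDefs._×_ rawMonoid n x

  ElementHasOrder : Carrier → ℕ → Set ℓ
  ElementHasOrder x n = 0 < n × pow x n ≈ ε × (∀ m → 0 < m → pow x m ≈ ε → n ≤ m)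

------------------------------------------------------------------------
-- Subgroups

record Subgroup {c ℓ : Level} (G : Group c ℓ) (p : Level) : Set (c ⊔ ℓ ⊔ suc p) where
  open Group G
  field
    member    : Pred Carrier p
    resp      : member Respects _≈_
    ε-closed  : ε ∈ member
    ∙-closed  : ∀ {x y} → x ∈ member → y ∈ member → x ∙ y ∈ member
    ⁻¹-closed : ∀ {x} → x ∈ member → x ⁻¹ ∈ member

module _ {c ℓ : Level} (G : Group c ℓ) where
  open Group G

  data Generated (g : Carrier) : Pred Carrier (c ⊔ ℓ) where
    gen  : Generated g g
    unit : Generated g ε
    mul  : ∀ {x y} → Generated g x → Generated g y → Generated g (x ∙ y)
    inv  : ∀ {x} → Generated g x → Generated g (x ⁻¹)
    resp : ∀ {x y} → x ≈ y → Generated g x → Generated g y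

  cyclic : Carrier → Subgroup G (c ⊔ ℓ)
  cyclic g = record
    { member    = Generated g
    ; resp      = resp
    ; ε-closed  = unit
    ; ∙-closed  = mul
    ; ⁻¹-closed = inv
    }

module _ {c ℓ : Level} (G : AbelianGroup c ℓ) where
  open AbelianGroup G
  open AbelianGroupProperties G
  open SetoidReasoning setoid

  productSubgroup : {p q : Level} → Subgroup group p → Subgroup group q →
                    Subgroup group (c ⊔ ℓ ⊔ p ⊔ q)
  productSubgroup P Q = record
    { member    = λ x → ∃[ y ] ∃[ z ] y ∈ P.member × z ∈ Q.member × x ≈ y ∙ z
    ; resp      = λ x≈x′ (y , z , y∈P , z∈Q , x≈yz) →
                    y , z , y∈P , z∈Q , trans (sym x≈x′) x≈yz
    ; ε-closed  = ε , ε , P.ε-closed , Q.ε-closed , sym (identityˡ ε)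
    ; ∙-closed  = λ {x} {x′} (y , z , y∈P , z∈Q , x≈yz) (y′ , z′ , y′∈P , z′∈Q , x′≈y′z′) →
        y ∙ y′ , z ∙ z′ , P.∙-closed y∈P y′∈P , Q.∙-closed z∈Q z′∈Q , (begin
          x ∙ x′                ≈⟨ ∙-cong x≈yz x′≈y′z′ ⟩
          (y ∙ z) ∙ (y′ ∙ z′)   ≈⟨ assoc y z (y′ ∙ z′) ⟩
          y ∙ (z ∙ (y′ ∙ z′))   ≈⟨ ∙-congˡ (assoc z y′ z′) ⟨
          y ∙ ((z ∙ y′) ∙ z′)   ≈⟨ ∙-congˡ (∙-congʳ (comm z y′)) ⟩
          y ∙ ((y′ ∙ z) ∙ z′)   ≈⟨ ∙-congˡ (assoc y′ z z′) ⟩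
          y ∙ (y′ ∙ (z ∙ z′))   ≈⟨ assoc y y′ (z ∙ z′) ⟨
          (y ∙ y′) ∙ (z ∙ z′)   ∎)
    ; ⁻¹-closed = λ {x} (y , z , y∈P , z∈Q , x≈yz) →
        y ⁻¹ , z ⁻¹ , P.⁻¹-closed y∈P , Q.⁻¹-closed z∈Q ,
        trans (⁻¹-cong x≈yz) (sym (⁻¹-∙-comm y z))
    }
    where
    module P = Subgroup P
    module Q = Subgroup Q

  -- Normality of the factors is automatic, G being abelian.
  record IsInternalDirectProduct {p q : Level} (P : Subgroup group p) (Q : Subgroup group q)
                                 : Set (c ⊔ ℓ ⊔ p ⊔ q) where
    private
      module P  = Subgroup P
      module Q  = Subgroup Q
      module PQ = Subgroup (productSubgroup P Q)
    field
      whole   : ∀ x → x ∈ PQ.member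
      trivial : ∀ {x} → x ∈ P.member → x ∈ Q.member → x ≈ ε

  subgroupAsGroup : {p : Level} → Subgroup group p → AbelianGroup (c ⊔ p) ℓ
  subgroupAsGroup P = record
    { Carrier = Σ Carrier P.member
    ; _≈_     = _≈_ on proj₁
    ; _∙_     = λ (x , x∈P) (y , y∈P) → x ∙ y , P.∙-closed x∈P y∈P
    ; ε       = ε , P.ε-closed
    ; _⁻¹     = λ (x , x∈P) → x ⁻¹ , P.⁻¹-closed x∈P
    ; isAbelianGroup = record
      { isGroup = record
        { isMonoid = record
          { isSemigroup = record
            { isMagma = record
              { isEquivalence = On.isEquivalence proj₁ isEquivalence
              ; ∙-cong        = ∙-cong
              }
            ; assoc = λ (x , _) (y , _) (z , _) → assoc x y z
            }
          ; identity = (λ (x , _) → identityˡ x) , (λ (x , _) → identityʳ x)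
          }
        ; inverse = (λ (x , _) → inverseˡ x) , (λ (x , _) → inverseʳ x)
        ; ⁻¹-cong = ⁻¹-cong
        }
      ; comm = λ (x , _) (y , _) → comm x y
      }
    }
    where module P = Subgroup P

------------------------------------------------------------------------
-- Generalized dihedral groups

module _ {c ℓ : Level} (B : AbelianGroup c ℓ) where
  open AbelianGroup B
  open AbelianGroupProperties B

  act : Sign → Carrier → Carrier
  act Sign.+ b = b
  act Sign.- b = b ⁻¹

  private
    act-cong : ∀ s {x y} → x ≈ y → act s x ≈ act s y
    act-cong Sign.+ x≈y = x≈y
    act-cong Sign.- x≈y = ⁻¹-cong x≈y

    act-∙ : ∀ s x y → act s (x ∙ y) ≈ act s x ∙ act s y
    act-∙ Sign.+ x y = refl
    act-∙ Sign.- x y = sym (⁻¹-∙-comm x y)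

    act-ε : ∀ s → act s ε ≈ ε
    act-ε Sign.+ = refl
    act-ε Sign.- = ε⁻¹≈ε

    act-* : ∀ s t x → act (s Sign.* t) x ≈ act s (act t x)
    act-* Sign.+ t      x = refl
    act-* Sign.- Sign.+ x = refl
    act-* Sign.- Sign.- x = sym (⁻¹-involutive x)

    act-square : ∀ s x → act s (act s x) ≈ x
    act-square Sign.+ x = refl
    act-square Sign.- x = ⁻¹-involutive x

  -- The semidirect product of B with the group {+ , -}, where - acts by
  -- inversion: (b , +) stands for b and (b , -) for b x.
  Dih : Group c ℓ
  Dih = record
    { Carrier = Carrier × Sign
    ; _≈_     = λ (b , s) (b′ , s′) → b ≈ b′ × s ≡ s′
    ; _∙_     = λ (b , s) (b′ , s′) → b ∙ act s b′ , s Sign.* s′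
    ; ε       = ε , Sign.+
    ; _⁻¹     = λ (b , s) → act s (b ⁻¹) , s
    ; isGroup = record
      { isMonoid = record
        { isSemigroup = record
          { isMagma = record
            { isEquivalence = record
              { refl  = refl , ≡.refl
              ; sym   = λ (p , q) → sym p , ≡.sym q
              ; trans = λ (p , q) (p′ , q′) → trans p p′ , ≡.trans q q′
              }
            ; ∙-cong = λ { {_ , s} (p , ≡.refl) (p′ , ≡.refl) →
                             ∙-cong p (act-cong s p′) , ≡.refl }
            }
          ; assoc = λ (x , s) (y , t) (z , u) →
              trans (assoc x (act s y) (act (s Sign.* t) z))
                    (∙-congˡ (trans (∙-congˡ (act-* s t z)) (sym (act-∙ s y (act t z)))))
              , Signₚ.*-assoc s t u
          }
        ; identity = (λ (x , s) → identityˡ x , ≡.refl)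
                   , (λ (x , s) → trans (∙-congˡ (act-ε s)) (identityʳ x) , Signₚ.*-identityʳ s)
        }
      ; inverse = (λ (x , s) → trans (sym (act-∙ s (x ⁻¹) x))
                                     (trans (act-cong s (inverseˡ x)) (act-ε s))
                             , Signₚ.s*s≡+ s)
                , (λ (x , s) → trans (∙-congˡ (act-square s (x ⁻¹))) (inverseʳ x)
                             , Signₚ.s*s≡+ s)
      ; ⁻¹-cong = λ { {_ , s} (p , ≡.refl) → act-cong s (⁻¹-cong p) , ≡.refl }
      }
    }

  private
    module D = Group Dih

    ι : Carrier → D.Carrier
    ι b = b , Sign.+

    x : D.Carrier
    x = ε , Sign.-

    x∉B : ∀ b → ¬ (ι b D.≈ x)
    x∉B b (_ , ())

    x²≈ε : x D.∙ x D.≈ D.ε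
    x²≈ε = trans (identityˡ (ε ⁻¹)) ε⁻¹≈ε , ≡.refl

    bx≈xb⁻¹ : ∀ b → ι b D.∙ x D.≈ x D.∙ ι (b ⁻¹)
    bx≈xb⁻¹ b = trans (identityʳ b) (sym (trans (identityˡ _) (⁻¹-involutive b))) , ≡.refl

{-# OPTIONS --safe #-}
-- Translations by elements of H together with the involution u ↦ c u⁻¹
-- generate a copy of Dih(H) inside Aut(Γ), the involution being an automorphism
-- because S = S⁻¹.  It acts regularly on G since H has index 2 and c ∉ H.
-- Explicitly, h ↦ h and h x ↦ h⁻¹ c is a bijection φ : Dih(H) → G with
-- φ(t d) = φ(t)^{±1} φ(d), the sign depending only on d; hence Γ is
-- isomorphic to Cay(Dih(H), φ⁻¹(S)).
module Submission where

open import Defs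
open import Algebra.Bundles using (AbelianGroup; Group)
open import Data.Nat.Base using (ℕ; _^_; _≤_; zero; suc; s≤s; z≤n)
import Data.Nat.Base as ℕ using (_*_)
open import Data.Nat.Divisibility.Core using (_∣_)
import Data.Nat.Properties as ℕₚ
open import Data.Product.Base using (_,_; proj₂)
open import Data.Sign.Base as Sign using ()
open import Data.Sum.Base as Sum using (_⊎_; inj₁; inj₂)
open import Function.Bundles using (Bijection; mk⇔)
open import Level using (Level)
open import Relation.Binary.PropositionalEquality.Core as ≡ using ()
open import Relation.Nullary.Negation using (¬_; contradiction)
open import Relation.Unary using (_∈_; _∉_)
import Algebra.Properties.AbelianGroup as AbelianGroupProperties
import Algebra.Properties.CommutativeMonoid.Mult as Mult
import Algebra.Properties.CommutativeSemigroup as CommutativeSemigroupProperties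
import Relation.Binary.Reasoning.Setoid as SetoidReasoning
open AbelianGroup using (Carrier; group)

private
  variable
    g ℓ a s p : Level

module _ (G : AbelianGroup g ℓ) where
  open AbelianGroup G hiding (Carrier; group)
  open AbelianGroupProperties G
  open CommutativeSemigroupProperties commutativeSemigroup
  open Mult commutativeMonoid using (×-congʳ; ×-distrib-+; ×-assocˡ)
  open SetoidReasoning setoid

  private
    _^^_ : Carrier G → ℕ → Carrier G
    _^^_ = pow (group G)

  -- Torsion and cosets in cyclic subgroups.

  ε^n≈ε : ∀ n → ε ^^ n ≈ ε
  ε^n≈ε zero  = refl
  ε^n≈ε (suc n) = trans (identityˡ _) (ε^n≈ε n)

  -- In an abelian group the elements killed by `n` form a subgroup, so it contains everything that
  -- `c` generates.
  Generated-torsion : ∀ {c x} n → c ^^ n ≈ ε → Generated (group G) c x → x ^^ n ≈ ε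
  Generated-torsion n cⁿ≈ε gen  = cⁿ≈ε
  Generated-torsion n cⁿ≈ε unit = ε^n≈ε n
  Generated-torsion n cⁿ≈ε (mul {x} {y} x∈ y∈) = begin
    (x ∙ y) ^^ n       ≈⟨ ×-distrib-+ x y n ⟩
    x ^^ n ∙ y ^^ n    ≈⟨ ∙-cong (Generated-torsion n cⁿ≈ε x∈) (Generated-torsion n cⁿ≈ε y∈) ⟩
    ε ∙ ε              ≈⟨ identityˡ ε ⟩
    ε                  ∎
  Generated-torsion n cⁿ≈ε (inv {x} x∈) = begin
    (x ⁻¹) ^^ n            ≈⟨ identityˡ _ ⟨
    ε ∙ (x ⁻¹) ^^ n        ≈⟨ ∙-congʳ (Generated-torsion n cⁿ≈ε x∈) ⟨
    x ^^ n ∙ (x ⁻¹) ^^ n   ≈⟨ ×-distrib-+ x (x ⁻¹) n ⟨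
    (x ∙ x ⁻¹) ^^ n        ≈⟨ ×-congʳ n (inverseʳ x) ⟩
    ε ^^ n                 ≈⟨ ε^n≈ε n ⟩
    ε                      ∎
  Generated-torsion n cⁿ≈ε (resp x≈y x∈) =
    trans (×-congʳ n (sym x≈y)) (Generated-torsion n cⁿ≈ε x∈)

  Generated-square : ∀ {c x} → Generated (group G) (c ^^ 2) x → Generated (group G) c x
  -- `c ^^ 2` unfolds to `c ∙ (c ∙ ε)`, hence the final `unit`.
  Generated-square gen          = mul gen (mul gen unit)
  Generated-square unit         = unit
  Generated-square (mul x∈ y∈)  = mul (Generated-square x∈) (Generated-square y∈)
  Generated-square (inv x∈)     = inv (Generated-square x∈)
  Generated-square (resp eq x∈) = resp eq (Generated-square x∈)

  -- Since `c ^^ 2` is killed by `2 ^ k`, so is all that it generates; were `c` among it, the order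
  -- of `c` would be at most `2 ^ k`, half of what it is.
  c∉⟨c²⟩ : ∀ {c} k → ElementHasOrder (group G) c (2 ^ suc k) → ¬ Generated (group G) (c ^^ 2) c
  c∉⟨c²⟩ {c} k (_ , cⁿ≈ε , minimal) c∈ =
    ℕₚ.<⇒≱ (ℕₚ.^-monoʳ-< 2 (s≤s (s≤s z≤n)) (ℕₚ.n<1+n k))
           (minimal (2 ^ k) (ℕₚ.m^n>0 2 k) (Generated-torsion (2 ^ k) c²-torsion c∈))
    where
    c²-torsion : (c ^^ 2) ^^ (2 ^ k) ≈ ε
    c²-torsion = begin
      (c ^^ 2) ^^ (2 ^ k)   ≈⟨ ×-assocˡ c (2 ^ k) 2 ⟩
      c ^^ (2 ^ k ℕ.* 2)    ≡⟨ ≡.cong (c ^^_) (ℕₚ.*-comm (2 ^ k) 2) ⟩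
      c ^^ (2 ^ suc k)      ≈⟨ cⁿ≈ε ⟩
      ε                     ∎

  module _ (H : Subgroup (group G) p) where
    private module H = Subgroup H

    -- Once `c ∙ c` lies in `H`, the union of `H` and `H c⁻¹` is a subgroup containing `c`.
    Generated-coset : ∀ {c x} → c ∙ c ∈ H.member → Generated (group G) c x →
                      x ∈ H.member ⊎ x ∙ c ∈ H.member
    Generated-coset c²∈ gen  = inj₂ c²∈
    Generated-coset c²∈ unit = inj₁ H.ε-closed
    Generated-coset {c} c²∈ (mul {x} {y} x∈ y∈)
      with Generated-coset c²∈ x∈ | Generated-coset c²∈ y∈
    ... | inj₁ x∈H  | inj₁ y∈H  = inj₁ (H.∙-closed x∈H y∈H)
    ... | inj₁ x∈H  | inj₂ yc∈H = inj₂ (H.resp (sym (assoc x y c)) (H.∙-closed x∈H yc∈H))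
    ... | inj₂ xc∈H | inj₁ y∈H  = inj₂ (H.resp (xy∙z≈xz∙y x c y) (H.∙-closed xc∈H y∈H))
    ... | inj₂ xc∈H | inj₂ yc∈H =
      -- The product of the two hypotheses is `x ∙ y` times `c ∙ c`, and `c ∙ c` is then divided
      -- out.
      inj₁ (H.resp (trans (∙-congʳ (interchange x c y c)) (//-rightDividesʳ (c ∙ c) (x ∙ y)))
                   (H.∙-closed (H.∙-closed xc∈H yc∈H) (H.⁻¹-closed c²∈)))
    Generated-coset {c} c²∈ (inv {x} x∈) with Generated-coset c²∈ x∈
    ... | inj₁ x∈H  = inj₁ (H.⁻¹-closed x∈H)
    ... | inj₂ xc∈H = inj₂ (H.resp eq (H.∙-closed (H.⁻¹-closed xc∈H) c²∈))
      where
      eq : (x ∙ c) ⁻¹ ∙ (c ∙ c) ≈ x ⁻¹ ∙ c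
      eq = begin
        (x ∙ c) ⁻¹ ∙ (c ∙ c)      ≈⟨ ∙-congʳ (⁻¹-∙-comm x c) ⟨
        x ⁻¹ ∙ c ⁻¹ ∙ (c ∙ c)     ≈⟨ assoc (x ⁻¹) (c ⁻¹) (c ∙ c) ⟩
        x ⁻¹ ∙ (c ⁻¹ ∙ (c ∙ c))   ≈⟨ ∙-congˡ (\\-leftDividesʳ c c) ⟩
        x ⁻¹ ∙ c                  ∎
    Generated-coset c²∈ (resp x≈y x∈) =
      Sum.map (H.resp x≈y) (H.resp (∙-congʳ x≈y)) (Generated-coset c²∈ x∈)

  -- The dihedral model of a group over a subgroup of index 2.

  module DihedralModel (H : Subgroup (group G) p) (c : Carrier G)
                       -- In the second case `h = x ⁻¹ ∙ c` is the solution of `h ⁻¹ ∙ c ≈ x`, which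
                       -- is what inverting `φ` requires.
                       (coset : ∀ x → x ∈ Subgroup.member H ⊎ x ⁻¹ ∙ c ∈ Subgroup.member H)
                       (c∉H : c ∉ Subgroup.member H) where
    private
      module H = Subgroup H
      D = Dih (subgroupAsGroup G H)
      module D = Group D

    act-cong : ∀ σ {x y} → x ≈ y → act G σ x ≈ act G σ y
    act-cong Sign.+ x≈y = x≈y
    act-cong Sign.- x≈y = ⁻¹-cong x≈y

    act-involutive : ∀ σ x → act G σ (act G σ x) ≈ x
    act-involutive Sign.+ x = refl
    act-involutive Sign.- x = ⁻¹-involutive x

    act-closed : (S : InverseClosedSubset (group G) s) → ∀ σ {x} →
                 x ∈ InverseClosedSubset.member S → act G σ x ∈ InverseClosedSubset.member S
    act-closed S Sign.+ x∈S = x∈S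
    act-closed S Sign.- x∈S = InverseClosedSubset.⁻¹-closed S x∈S

    -- Inverting `h` on reflections makes the sign in `φ-∙` fall on the left factor; with `h ∙ c` it
    -- would fall on the right one.
    φ : D.Carrier → Carrier G
    φ ((h , _) , Sign.+) = h
    φ ((h , _) , Sign.-) = h ⁻¹ ∙ c

    φ-cong : ∀ {d e} → d D.≈ e → φ d ≈ φ e
    φ-cong {_ , Sign.+} (h≈ , ≡.refl) = h≈
    φ-cong {_ , Sign.-} (h≈ , ≡.refl) = ∙-congʳ (⁻¹-cong h≈)

    -- Otherwise `c ≈ k ∙ h` would lie in `H`. Thus rotations and reflections have disjoint images
    -- under `φ`.
    h≉k⁻¹c : ∀ {h k} → h ∈ H.member → k ∈ H.member → ¬ h ≈ k ⁻¹ ∙ c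
    h≉k⁻¹c {h} {k} h∈ k∈ h≈k⁻¹c =
      c∉H (H.resp (trans (∙-congˡ h≈k⁻¹c) (\\-leftDividesˡ k c)) (H.∙-closed k∈ h∈))

    φ-injective : ∀ {d e} → φ d ≈ φ e → d D.≈ e
    φ-injective {_ , Sign.+}        {_ , Sign.+}        eq = eq , ≡.refl
    φ-injective {(_ , h∈) , Sign.+} {(_ , k∈) , Sign.-} eq = contradiction eq (h≉k⁻¹c h∈ k∈)
    φ-injective {(_ , h∈) , Sign.-} {(_ , k∈) , Sign.+} eq = contradiction (sym eq) (h≉k⁻¹c k∈ h∈)
    φ-injective {_ , Sign.-}        {_ , Sign.-}        eq = ⁻¹-injective (∙-cancelʳ c _ _ eq) , ≡.refl

    -- Not a homomorphism, but adjacency multiplies on the left by an element of the connection set,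
    -- and there closure under inversion absorbs the sign.
    φ-∙ : ∀ t d → φ (t D.∙ d) ≈ act G (proj₂ d) (φ t) ∙ φ d
    φ-∙ ((x , _) , Sign.+) ((y , _) , Sign.+) = refl
    φ-∙ ((x , _) , Sign.-) ((y , _) , Sign.+) = begin
      (x ∙ y ⁻¹) ⁻¹ ∙ c      ≈⟨ ∙-congʳ (⁻¹-∙-comm x (y ⁻¹)) ⟨
      x ⁻¹ ∙ y ⁻¹ ⁻¹ ∙ c     ≈⟨ ∙-congʳ (∙-congˡ (⁻¹-involutive y)) ⟩
      x ⁻¹ ∙ y ∙ c           ≈⟨ xy∙z≈xz∙y (x ⁻¹) y c ⟩
      x ⁻¹ ∙ c ∙ y           ∎
    φ-∙ ((x , _) , Sign.+) ((y , _) , Sign.-) = begin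
      (x ∙ y) ⁻¹ ∙ c         ≈⟨ ∙-congʳ (⁻¹-∙-comm x y) ⟨
      x ⁻¹ ∙ y ⁻¹ ∙ c        ≈⟨ assoc (x ⁻¹) (y ⁻¹) c ⟩
      x ⁻¹ ∙ (y ⁻¹ ∙ c)      ∎
    φ-∙ ((x , _) , Sign.-) ((y , _) , Sign.-) = begin
      x ∙ y ⁻¹                          ≈⟨ ∙-congˡ (//-rightDividesʳ c (y ⁻¹)) ⟨
      x ∙ (y ⁻¹ ∙ c ∙ c ⁻¹)             ≈⟨ x∙yz≈xz∙y x (y ⁻¹ ∙ c) (c ⁻¹) ⟩
      x ∙ c ⁻¹ ∙ (y ⁻¹ ∙ c)             ≈⟨ ∙-congʳ (∙-congʳ (⁻¹-involutive x)) ⟨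
      x ⁻¹ ⁻¹ ∙ c ⁻¹ ∙ (y ⁻¹ ∙ c)       ≈⟨ ∙-congʳ (⁻¹-∙-comm (x ⁻¹) c) ⟩
      (x ⁻¹ ∙ c) ⁻¹ ∙ (y ⁻¹ ∙ c)        ∎

    φ⁻¹ : Carrier G → D.Carrier
    φ⁻¹ x with coset x
    ... | inj₁ x∈H    = (x , x∈H) , Sign.+
    ... | inj₂ x⁻¹c∈H = (x ⁻¹ ∙ c , x⁻¹c∈H) , Sign.-

    φ-φ⁻¹ : ∀ x → φ (φ⁻¹ x) ≈ x
    φ-φ⁻¹ x with coset x
    ... | inj₁ _ = refl
    ... | inj₂ _ = begin
      (x ⁻¹ ∙ c) ⁻¹ ∙ c         ≈⟨ ∙-congʳ (⁻¹-∙-comm (x ⁻¹) c) ⟨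
      x ⁻¹ ⁻¹ ∙ c ⁻¹ ∙ c        ≈⟨ //-rightDividesˡ c (x ⁻¹ ⁻¹) ⟩
      x ⁻¹ ⁻¹                   ≈⟨ ⁻¹-involutive x ⟩
      x                         ∎

    φ⁻¹-bijection : Bijection setoid D.setoid
    φ⁻¹-bijection = record
      { to        = φ⁻¹
      -- `coset` may choose differently on equal arguments, so congruence comes from the injectivity
      -- of `φ`.
      ; cong      = λ {x} {y} x≈y →
          φ-injective (trans (φ-φ⁻¹ x) (trans x≈y (sym (φ-φ⁻¹ y))))
      ; bijective = (λ {x} {y} eq → trans (sym (φ-φ⁻¹ x)) (trans (φ-cong eq) (φ-φ⁻¹ y)))
                  , (λ d → φ d , λ {x} x≈φd → φ-injective (trans (φ-φ⁻¹ x) x≈φd))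
      }

    module _ (S : InverseClosedSubset (group G) s) where
      private module S = InverseClosedSubset S

      connectionSet : InverseClosedSubset D s
      connectionSet = record
        { member    = λ d → φ d ∈ S.member
        ; resp      = λ d≈e → S.resp (φ-cong d≈e)
        ; ⁻¹-closed = λ {d} → closed d
        }
        where
        closed : ∀ d → φ d ∈ S.member → φ (d D.⁻¹) ∈ S.member
        closed (_ , Sign.+)       φd∈S = S.⁻¹-closed φd∈S
        -- A reflection is its own inverse, up to a double inversion.
        closed ((h , _) , Sign.-) φd∈S = S.resp (∙-congʳ (sym (⁻¹-involutive (h ⁻¹)))) φd∈S

      cayley-Dih : IsCayleyGraphOn s (Cay (group G) S) D
      cayley-Dih = connectionSet , record
        { bijection = φ⁻¹-bijection
        ; adjacency = λ u v → mk⇔ (forward u v) (backward u v)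
        }
        where
        module Γ = Graph (Cay (group G) S)
        module Δ = Graph (Cay D connectionSet)

        φ-step : ∀ t u → φ (t D.∙ φ⁻¹ u) ≈ act G (proj₂ (φ⁻¹ u)) (φ t) ∙ u
        φ-step t u = trans (φ-∙ t (φ⁻¹ u)) (∙-congˡ (φ-φ⁻¹ u))

        forward : ∀ u v → Γ.Adj u v → Δ.Adj (φ⁻¹ u) (φ⁻¹ v)
        forward u v (r , r∈S , v≈ru) =
          t , S.resp (sym (φ-φ⁻¹ (act G σ r))) (act-closed S σ r∈S) , φ-injective (begin
            φ (φ⁻¹ v)                ≈⟨ φ-φ⁻¹ v ⟩
            v                        ≈⟨ v≈ru ⟩
            r ∙ u                    ≈⟨ ∙-congʳ (act-involutive σ r) ⟨
            act G σ (act G σ r) ∙ u  ≈⟨ ∙-congʳ (act-cong σ (φ-φ⁻¹ (act G σ r))) ⟨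
            act G σ (φ t) ∙ u        ≈⟨ φ-step t u ⟨
            φ (t D.∙ φ⁻¹ u)          ∎)
          where
          σ = proj₂ (φ⁻¹ u)
          -- Left multiplication by `t` applies the sign of `φ⁻¹ u` to `φ t`; twisting `r` by it
          -- beforehand makes the two signs cancel.
          t = φ⁻¹ (act G σ r)

        backward : ∀ u v → Δ.Adj (φ⁻¹ u) (φ⁻¹ v) → Γ.Adj u v
        backward u v (t , φt∈S , φ⁻¹v≈tφ⁻¹u) =
          act G σ (φ t) , act-closed S σ φt∈S , (begin
            v                   ≈⟨ φ-φ⁻¹ v ⟨
            φ (φ⁻¹ v)           ≈⟨ φ-cong φ⁻¹v≈tφ⁻¹u ⟩
            φ (t D.∙ φ⁻¹ u)     ≈⟨ φ-step t u ⟩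
            act G σ (φ t) ∙ u   ∎)
          where
          σ = proj₂ (φ⁻¹ u)

  -- The subgroup generated by `c ^^ 2` and `A` has index 2.

  module _ (c : Carrier G) (A : Subgroup (group G) a)
           (G≈⟨c⟩×A : IsInternalDirectProduct G (cyclic (group G) c) A) where
    private
      H = productSubgroup G (cyclic (group G) (c ^^ 2)) A
      module A = Subgroup A
      module H = Subgroup H
    open IsInternalDirectProduct G≈⟨c⟩×A

    c∙c∈H : c ∙ c ∈ H.member
    c∙c∈H = c ^^ 2 , ε , gen , A.ε-closed ,
            sym (trans (identityʳ _) (∙-congˡ (identityʳ c)))

    A⊆H : ∀ {x} → x ∈ A.member → x ∈ H.member
    A⊆H {x} x∈A = ε , x , unit , x∈A , sym (identityˡ x)

    H-coset : ∀ x → x ∈ H.member ⊎ x ⁻¹ ∙ c ∈ H.member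
    H-coset x with whole x
    ... | y , z , y∈⟨c⟩ , z∈A , x≈yz =
      Sum.map (λ y∈H → H.resp (sym x≈yz) (H.∙-closed y∈H (A⊆H z∈A)))
              (λ y⁻¹c∈H → H.resp eq (H.∙-closed y⁻¹c∈H (H.⁻¹-closed (A⊆H z∈A))))
              -- The dichotomy is applied to `y ⁻¹`, so that its second case already has the form
              -- `y ⁻¹ ∙ c`; the first is inverted back.
              (Sum.map₁ (λ y⁻¹∈H → H.resp (⁻¹-involutive y) (H.⁻¹-closed y⁻¹∈H))
                        (Generated-coset H c∙c∈H (inv y∈⟨c⟩)))
      where
      eq : y ⁻¹ ∙ c ∙ z ⁻¹ ≈ x ⁻¹ ∙ c
      eq = begin
        y ⁻¹ ∙ c ∙ z ⁻¹   ≈⟨ xy∙z≈xz∙y (y ⁻¹) c (z ⁻¹) ⟩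
        y ⁻¹ ∙ z ⁻¹ ∙ c   ≈⟨ ∙-congʳ (⁻¹-∙-comm y z) ⟩
        (y ∙ z) ⁻¹ ∙ c    ≈⟨ ∙-congʳ (⁻¹-cong x≈yz) ⟨
        x ⁻¹ ∙ c          ∎

    -- If `c ≈ y ∙ z`, then `z ≈ y ⁻¹ ∙ c` lies in both direct factors and is trivial, which puts
    -- `c` itself in the subgroup generated by `c ^^ 2`.
    c∉H : ∀ k → ElementHasOrder (group G) c (2 ^ suc k) → c ∉ H.member
    c∉H k c-order (y , z , y∈⟨c²⟩ , z∈A , c≈yz) = c∉⟨c²⟩ k c-order (resp y≈c y∈⟨c²⟩)
      where
      z∈⟨c⟩ : Generated (group G) c z
      z∈⟨c⟩ = resp (trans (∙-congˡ c≈yz) (\\-leftDividesʳ y z))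
                   (mul (inv (Generated-square y∈⟨c²⟩)) gen)

      y≈c : y ≈ c
      y≈c = begin
        y       ≈⟨ identityʳ y ⟨
        y ∙ ε   ≈⟨ ∙-congˡ (trivial z∈⟨c⟩ z∈A) ⟨
        y ∙ z   ≈⟨ c≈yz ⟨
        c       ∎

theorem2p3 : {g ℓ a s : Level} (G : AbelianGroup g ℓ) →
    (n : ℕ) → GroupHasOrder (group G) n → 2 ∣ n →
    (c : Carrier G) (k : ℕ) → 1 ≤ k → ElementHasOrder (group G) c (2 ^ k) →
    (A : Subgroup (group G) a) → IsInternalDirectProduct G (cyclic (group G) c) A →
    (S : InverseClosedSubset (group G) s) →
    let H = productSubgroup G (cyclic (group G) (pow (group G) c 2)) A in
    IsCayleyGraphOn s (Cay (group G) S) (Dih (subgroupAsGroup G H))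
-- `1 ≤ k` excludes exponent zero, where `c` would be trivial and lie in `H`.
theorem2p3 G _ _ _ c (suc k) _ c-order A G≈⟨c⟩×A S =
  DihedralModel.cayley-Dih G H c (H-coset G c A G≈⟨c⟩×A) (c∉H G c A G≈⟨c⟩×A k c-order) S
  where H = productSubgroup G (cyclic (group G) (pow (group G) c 2)) A
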